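{- Let $V$ be a generalized bijective variety with theory $T$ in the language $L=\{f_1,\ldots,f_m\}$ of unary function symbols. (1) Any elementary first-order $L$-sentence $\varphi$ is equivalent over $T$ to a sentence $\varphi^*$ that is a finite Boolean combination of local sentences. (2) Any elementary first-order $L$-formula $\varphi(\bar x)$ with free variables $\bar x$ is equivalent over $T$ to a formula $\varphi^*(\bar x)$ that is a finite Boolean combination of local sentences and local formulas. In fact, we may take $\varphi^*(\bar x)$ to be a finite disjunction of formulas $\alpha_i(\bar x)\ \&\ \beta_i$, where for each $i$, $\alpha_i(\bar x)$ is a single local formula and $\beta_i$ is a finite conjunction of local sentences and negations of local sentences.
   Context: A variety is a class of structures axiomatized by universally quantified equations; its theory $T$ is the set of logical consequences of the axioms. $V$ is generalized bijective if for each $i$, $T\vdash(\forall x,y)(f_i(x)=f_i(y)\to x=y)$ and $T\vdash(\forall y)(\exists x)\,f_i(x)=y$. For an $L$-structure $\mathcal{A}$, the Gaifman graph is the undirected graph on the universe of $\mathcal{A}$ with an edge between $x$ and $y$ iff $f_i(x)=y$ or $f_i(y)=x$ for some $i$. The distance $d(x,y)$ is the least length of a path from $x$ to $y$ (infinite if there is none), and $d^{>2r}(x,y)$ is the formula expressing $d(x,y)>2r$. $B_r(a)=\{x: d(a,x)\le r\}$, and $B_r(\bar a)=\bigcup_i B_r(a_i)$; these are regarded as substructures with the functions $f_i$ treated as binary relations. For each $r,n$ fix a finite set $C_{r,n}$ of $L$-formulas $\alpha(\bar x)$ in an $n$-tuple of variables such that (i) for each $\mathcal{A}\in V$, each $n$-tuple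 in $\mathcal{A}$ satisfies a unique $\alpha\in C_{r,n}$; (ii) for all $\mathcal{A},\mathcal{A}'\in V$, if $n$-tuples $\bar a$ in $\mathcal{A}$ and $\bar a'$ in $\mathcal{A}'$ satisfy the same $\alpha\in C_{r,n}$, then there is an isomorphism from $B_r(\bar a)$ onto $B_r(\bar a')$ taking $\bar a$ to $\bar a'$. (Such sets exist for any generalized bijective variety: the formulas describe the atomic diagram of $B_r(\bar x)$, and may be taken existential, or universal.) The $r$-local formulas are those in $C_{r,n}$ for various $n$. The $r$-local sentences are those of the form $(\exists v_1,\ldots,v_s)\big(\bigwedge_i\alpha_i(v_i)\ \&\ \bigwedge_{i<j}d^{>2r}(v_i,v_j)\big)$ for some $s$ and $\alpha_i\in C_{r,1}$, or $(\exists v)\alpha(v)$ for some $\alpha\in C_{r,1}$. A formula or sentence is local if it is $r$-local for some $r$. -}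

module Defs where

open import Data.Empty using (⊥)
open import Data.Fin using (Fin; zero; suc; Fin′; inject)
open import Data.List using (List; foldr)
import Data.List as List
open import Data.List.Membership.Propositional using (_∈_)
open import Data.List.Relation.Unary.All using (All)
open import Data.Nat using (ℕ; zero; suc; _≤_; _*_)
open import Data.Product using (Σ; ∃-syntax; ∃!; _×_; proj₁)
open import Data.Sum using (_⊎_)
open import Data.Vec using (Vec; []; _∷_; lookup)
open import Function.Bundles using (_⇔_; Inverse)
open import Level using (0ℓ) renaming (suc to lsuc)
open import Relation.Binary.Bundles using (Setoid)
import Relation.Binary.Construct.On as On
open import Relation.Binary.PropositionalEquality using (_≡_; setoid)
open import Relation.Unary using (Pred)
import Relation.Unary as U

private variable
  m n k : ℕ

------------------------------------------------------------------------
-- First-order logic over m unary function symbols, with n free variables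
-- represented as de Bruijn indices.

data Term (m n : ℕ) : Set where
  var : Fin n → Term m n
  fun : Fin m → Term m n → Term m n

infix  9 _≐_
infixr 7 _∧′_
infixr 6 _∨′_
infixr 5 _⇒′_
infix  4 _⇔′_

data Formula (m : ℕ) : ℕ → Set where
  _≐_            : Term m n → Term m n → Formula m n
  ⊥′             : Formula m n
  _∧′_ _∨′_ _⇒′_ : Formula m n → Formula m n → Formula m n
  ∀′ ∃′          : Formula m (suc n) → Formula m n

Sentence : ℕ → Set
Sentence m = Formula m 0

⊤′ : Formula m n
⊤′ = ⊥′ ⇒′ ⊥′

¬′_ : Formula m n → Formula m n
¬′ φ = φ ⇒′ ⊥′

_⇔′_ : Formula m n → Formula m n → Formula m n
φ ⇔′ ψ = (φ ⇒′ ψ) ∧′ (ψ ⇒′ φ)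

⋀ ⋁ : List (Formula m n) → Formula m n
⋀ = foldr _∧′_ ⊤′
⋁ = foldr _∨′_ ⊥′

⋀[_] ⋁[_] : (k : ℕ) → (Fin k → Formula m n) → Formula m n
⋀[ k ] φ = ⋀ (List.tabulate φ)
⋁[ k ] φ = ⋁ (List.tabulate φ)

∀* ∃* : (n : ℕ) → Formula m n → Sentence m
∀* zero    φ = φ
∀* (suc n) φ = ∀* n (∀′ φ)
∃* zero    φ = φ
∃* (suc n) φ = ∃* n (∃′ φ)

renameTerm : (Fin n → Fin k) → Term m n → Term m k
renameTerm ρ (var x)   = var (ρ x)
renameTerm ρ (fun i t) = fun i (renameTerm ρ t)

lift : (Fin n → Fin k) → Fin (suc n) → Fin (suc k)
lift ρ zero    = zero
lift ρ (suc x) = suc (ρ x)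

rename : (Fin n → Fin k) → Formula m n → Formula m k
rename ρ (s ≐ t)  = renameTerm ρ s ≐ renameTerm ρ t
rename ρ ⊥′       = ⊥′
rename ρ (φ ∧′ ψ) = rename ρ φ ∧′ rename ρ ψ
rename ρ (φ ∨′ ψ) = rename ρ φ ∨′ rename ρ ψ
rename ρ (φ ⇒′ ψ) = rename ρ φ ⇒′ rename ρ ψ
rename ρ (∀′ φ)   = ∀′ (rename (lift ρ) φ)
rename ρ (∃′ φ)   = ∃′ (rename (lift ρ) φ)

-- A sentence regarded as a formula in n (unused) free variables.
weaken : Sentence m → Formula m n
weaken = rename λ ()

-- The formula α(v).
_⟨_⟩ : Formula m 1 → Fin n → Formula m n
α ⟨ v ⟩ = rename (λ _ → v) α

record Structure (m : ℕ) : Set₁ where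
  field
    Carrier  : Set
    nonempty : Carrier
    fn       : Fin m → Carrier → Carrier

open Structure using (Carrier; fn)

⟦_⟧ : Term m n → (A : Structure m) → Vec (Carrier A) n → Carrier A
⟦ var x   ⟧ A a = lookup a x
⟦ fun i t ⟧ A a = fn A i (⟦ t ⟧ A a)

-- Satisfaction.  It is read in the metatheory, so it is the usual classical
-- one when excluded middle is assumed there.
infix 3 _⊨_[_] _⊨_
_⊨_[_] : (A : Structure m) → Formula m n → Vec (Carrier A) n → Set
A ⊨ s ≐ t  [ a ] = ⟦ s ⟧ A a ≡ ⟦ t ⟧ A a
A ⊨ ⊥′     [ a ] = ⊥
A ⊨ φ ∧′ ψ [ a ] = (A ⊨ φ [ a ]) × (A ⊨ ψ [ a ])
A ⊨ φ ∨′ ψ [ a ] = (A ⊨ φ [ a ]) ⊎ (A ⊨ ψ [ a ])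
A ⊨ φ ⇒′ ψ [ a ] = A ⊨ φ [ a ] → A ⊨ ψ [ a ]
A ⊨ ∀′ φ   [ a ] = (x : Carrier A) → A ⊨ φ [ x ∷ a ]
A ⊨ ∃′ φ   [ a ] = Σ (Carrier A) λ x → A ⊨ φ [ x ∷ a ]

_⊨_ : Structure m → Sentence m → Set
A ⊨ σ = A ⊨ σ [ [] ]

------------------------------------------------------------------------
-- Varieties

-- The equation ∀ x₁ … xₖ. lhs = rhs.
record Equation (m : ℕ) : Set where
  constructor equation
  field
    {vars}  : ℕ
    lhs rhs : Term m vars

universally : Equation m → Sentence m
universally (equation {k} s t) = ∀* k (s ≐ t)

-- A variety is given by a (possibly infinite) set of equational axioms.
Variety : ℕ → Set₁
Variety m = Pred (Equation m) 0ℓ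

infix 4 _∈ᵛ_
_∈ᵛ_ : Structure m → Variety m → Set
A ∈ᵛ V = ∀ e → V e → A ⊨ universally e

Theory : Variety m → Pred (Sentence m) (lsuc 0ℓ)
Theory V σ = ∀ A → A ∈ᵛ V → A ⊨ σ

infix 2 _⊢_
_⊢_ : Variety m → Sentence m → Set₁
V ⊢ σ = σ U.∈ Theory V

GeneralizedBijective : Variety m → Set₁
GeneralizedBijective {m} V = (i : Fin m) →
    (V ⊢ ∀′ (∀′ (fun i (var x) ≐ fun i (var y) ⇒′ var x ≐ var y)))
  × (V ⊢ ∀′ (∃′ (fun i (var y) ≐ var x)))
  where
  x y : Fin 2
  x = suc zero
  y = zero

EquivalentOver : Variety m → Formula m n → Formula m n → Set₁
EquivalentOver {n = n} V φ ψ = V ⊢ ∀* n (φ ⇔′ ψ)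

------------------------------------------------------------------------
-- The Gaifman graph

module Gaifman (A : Structure m) where

  Edge : Carrier A → Carrier A → Set
  Edge x y = ∃[ i ] (fn A i x ≡ y ⊎ fn A i y ≡ x)

  data Path : ℕ → Carrier A → Carrier A → Set where
    []  : ∀ {x} → Path 0 x x
    _∷_ : ∀ {l x y z} → Edge x y → Path l y z → Path (suc l) x z

  -- d(x , y) ≤ r
  Within : ℕ → Carrier A → Carrier A → Set
  Within r x y = ∃[ l ] (l ≤ r × Path l x y)

  InBall : ℕ → Vec (Carrier A) n → Carrier A → Set
  InBall r a x = ∃[ i ] Within r (lookup a i) x

  -- Points of the ball are compared as elements of A, ignoring the
  -- membership witness.
  Ball : ℕ → Vec (Carrier A) n → Setoid 0ℓ 0ℓ
  Ball r a = On.setoid {B = Σ (Carrier A) (InBall r a)} (setoid (Carrier A)) proj₁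

open Gaifman using (Ball; InBall)

-- Isomorphisms B_r(a) ≅ B_r(b) of the induced relational substructures (each
-- fᵢ being the relation fᵢ(x) = y between points of the ball), taking a to b.
record BallIso (r : ℕ) (A B : Structure m)
               (a : Vec (Carrier A) n) (b : Vec (Carrier B) n) : Set where
  field
    bijection : Inverse (Ball A r a) (Ball B r b)

  to : Σ (Carrier A) (InBall A r a) → Carrier B
  to x = proj₁ (Inverse.to bijection x)

  field
    preserves : ∀ i x y → (fn A i (proj₁ x) ≡ proj₁ y) ⇔ (fn B i (to x) ≡ to y)
    tuple     : ∀ j x → proj₁ x ≡ lookup a j → to x ≡ lookup b j

edge : Fin n → Fin n → Formula m n
edge {m = m} x y =
  ⋁[ m ] λ i → fun i (var x) ≐ var y ∨′ fun i (var y) ≐ var x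

d≤ : ℕ → Fin n → Fin n → Formula m n
d≤ zero    x y = var x ≐ var y
d≤ (suc r) x y = var x ≐ var y ∨′ ∃′ (edge (suc x) zero ∧′ d≤ r zero (suc y))

d> : ℕ → Fin n → Fin n → Formula m n
d> r x y = ¬′ d≤ r x y

------------------------------------------------------------------------
-- Local formulas and sentences

-- A choice of finite sets C r n of formulas in n variables.
Choice : ℕ → Set
Choice m = ℕ → (n : ℕ) → List (Formula m n)

record Admissible (V : Variety m) (C : Choice m) : Set₁ where
  field
    unique : ∀ r n (A : Structure m) → A ∈ᵛ V → (a : Vec (Carrier A) n) →
             ∃! _≡_ λ α → α ∈ C r n × (A ⊨ α [ a ])
    iso    : ∀ r n (A B : Structure m) → A ∈ᵛ V → B ∈ᵛ V →
             (a : Vec (Carrier A) n) (b : Vec (Carrier B) n) →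
             ∀ α → α ∈ C r n → A ⊨ α [ a ] → B ⊨ α [ b ] → BallIso r A B a b

LocalFormula : Choice m → Pred (Formula m n) 0ℓ
LocalFormula {n = n} C φ = ∃[ r ] φ ∈ C r n

-- In the second conjunct, inject j ranges over the indices below i.
scattered : ℕ → (s : ℕ) → (Fin s → Formula m 1) → Sentence m
scattered r s α = ∃* s
  ( (⋀[ s ] λ i → α i ⟨ i ⟩)
  ∧′ (⋀[ s ] λ i → ⋀[ _ ] λ (j : Fin′ i) → d> (2 * r) (inject j) i))

data LocalSentence (C : Choice m) : Pred (Sentence m) 0ℓ where
  scatteredᴸ : ∀ r s (α : Fin (suc s) → Formula m 1) → (∀ i → α i ∈ C r 1) →
               LocalSentence C (scattered r (suc s) α)
  existsᴸ    : ∀ r (α : Formula m 1) → α ∈ C r 1 → LocalSentence C (∃′ α)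

-- Finite Boolean combinations of formulas satisfying G (⊥′ being the empty
-- disjunction).
data BooleanCombination (G : Pred (Formula m n) 0ℓ) : Pred (Formula m n) 0ℓ where
  gen  : ∀ {φ} → G φ → BooleanCombination G φ
  bot  : BooleanCombination G ⊥′
  neg  : ∀ {φ} → BooleanCombination G φ → BooleanCombination G (¬′ φ)
  conj : ∀ {φ ψ} → BooleanCombination G φ → BooleanCombination G ψ →
         BooleanCombination G (φ ∧′ ψ)
  disj : ∀ {φ ψ} → BooleanCombination G φ → BooleanCombination G ψ →
         BooleanCombination G (φ ∨′ ψ)

data Local (C : Choice m) : Pred (Formula m n) 0ℓ where
  formula  : ∀ {α : Formula m n} → LocalFormula C α → Local C α
  sentence : ∀ {σ} → LocalSentence C σ → Local C (weaken {n = n} σ)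

data Literal (C : Choice m) : Pred (Sentence m) 0ℓ where
  pos : ∀ {σ} → LocalSentence C σ → Literal C σ
  neg : ∀ {σ} → LocalSentence C σ → Literal C (¬′ σ)

-- α(x̄) & β
data Disjunct (C : Choice m) : Pred (Formula m n) 0ℓ where
  disjunct : ∀ {α : Formula m n} {βs} → LocalFormula C α → All (Literal C) βs →
             Disjunct C (α ∧′ weaken (⋀ βs))

NormalForm : Choice m → Pred (Formula m n) 0ℓ
NormalForm C φ = ∃[ ψs ] (All (Disjunct C) ψs × φ ≡ ⋁ ψs)

{-# OPTIONS --safe #-}
module Submission where

-- For every formula φ, the truth of φ(a) is preserved by isomorphisms of balls
-- around a of a suitable radius, between structures that agree on finitely many
-- local sentences; φ is then the disjunction of the consistent combinations of a
-- local formula and a truth assignment to those sentences.  In the quantifier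
-- step a new point x is moved by the given isomorphism if it is near a.  If it is
-- far, B must have a point y far from b whose R-ball is a copy of that of x:
-- otherwise all such copies lie near b, a 2R-scattered set of them pulls back to
-- A, where x enlarges it, and the larger set is transferred to B by a local
-- sentence.  This would produce n + 1 scattered points within R of the n entries
-- of b.

open import Defs
open import Axiom.ExcludedMiddle using (ExcludedMiddle)
open import Data.Empty using (⊥; ⊥-elim)
open import Data.Fin using (Fin; zero; suc; Fin′; inject; _<_)
open import Data.Fin.Properties using (pigeonhole)
open import Data.List
  using (List; []; _∷_; _++_; map; filter; concatMap; upTo; cartesianProductWith)
import Data.List as List
open import Data.List.Membership.Propositional using (_∈_; find; lose)
open import Data.List.Membership.Propositional.Properties
  using (∈-map⁺; ∈-map⁻; ∈-++⁺ˡ; ∈-++⁺ʳ; ∈-++⁻; ∈-filter⁺; ∈-filter⁻; ∈-upTo⁺;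
         ∈-concatMap⁺; ∈-concatMap⁻; ∈-cartesianProductWith⁺; ∈-cartesianProductWith⁻)
open import Data.List.Relation.Unary.All using (All; []; _∷_)
import Data.List.Relation.Unary.All as All
import Data.List.Relation.Unary.All.Properties as All
import Data.List.Relation.Unary.Any.Properties as Any
open import Data.List.Relation.Unary.Any using (Any; here; there)
open import Data.Nat as ℕ using (ℕ; zero; suc; _+_; _*_; _≤_; z≤n; s≤s; _⊔_)
open import Data.Nat.Properties
  using (≤-refl; ≤-trans; ≤-reflexive; <⇒≤; m≤m+n; m≤n+m; +-mono-≤; +-monoʳ-≤;
         +-comm; +-assoc; +-identityʳ; m≤m⊔n; m≤n⊔m)
open import Data.Product using (Σ; ∃-syntax; _×_; _,_; proj₁; proj₂)
import Data.Product as Product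
open import Data.Sum using (_⊎_; inj₁; inj₂)
import Data.Sum as Sum
open import Data.Vec using (Vec; []; _∷_; lookup; tabulate)
open import Data.Vec.Properties using (lookup∘tabulate)
import Data.Vec.Functional as F
open import Function using (_∘_; _⇔_; mk⇔; Equivalence; Inverse)
open import Function.Construct.Symmetry using (⇔-sym)
open import Function.Construct.Composition using (_⇔-∘_)
import Level
open import Level using (0ℓ; Lift) renaming (suc to lsuc)
open import Relation.Binary.PropositionalEquality
  using (_≡_; refl; sym; trans; cong; subst)
open import Relation.Nullary using (¬_; Dec; yes; no; map′; decidable-stable)
open import Relation.Unary using (Pred)

open Structure using (Carrier; fn)
open Gaifman using (Edge; Path; []; _∷_; Within; InBall)
open Equivalence using (to; from)

private variable
  m n k l p q r : ℕ
  A : Structure m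

-- Distances in the Gaifman graph

edge-sym : ∀ {x y} → Edge A x y → Edge A y x
edge-sym (i , e) = i , Sum.swap e

edge⇒within : ∀ {x y} → Edge A x y → Within A 1 x y
edge⇒within e = 1 , ≤-refl , e ∷ []

path-++ : ∀ {x y z} → Path A k x y → Path A l y z → Path A (k + l) x z
path-++ []      π′ = π′
path-++ (e ∷ π) π′ = e ∷ path-++ π π′

within-refl : ∀ {x} → Within A r x x
within-refl = 0 , z≤n , []

within-mono : ∀ {x y} → p ≤ q → Within A p x y → Within A q x y
within-mono p≤q (l , l≤p , π) = l , ≤-trans l≤p p≤q , π

within-trans : ∀ {x y z} → Within A p x y → Within A q y z → Within A (p + q) x z
within-trans (k , k≤p , π) (l , l≤q , π′) = k + l , +-mono-≤ k≤p l≤q , path-++ π π′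

≡⇒within : ∀ {x y} → x ≡ y → Within A r x y
≡⇒within refl = within-refl

within-zero : ∀ {x y} → Within A 0 x y → x ≡ y
within-zero (_ , z≤n , []) = refl

within-suc : ∀ {x y} → Within A (suc r) x y → x ≡ y ⊎ (∃[ z ] (Edge A x z × Within A r z y))
within-suc (_ , _       , [])    = inj₁ refl
within-suc (_ , s≤s l≤r , e ∷ π) = inj₂ (_ , e , _ , l≤r , π)

within-sym : ∀ {x y} → Within A r x y → Within A r y x
within-sym (l , l≤r , π) = within-mono l≤r (reverse π)
  where
  reverse : ∀ {l x y} → Path A l x y → Within A l y x
  reverse []                = within-refl
  reverse {A = A} {suc l} (e ∷ π) = within-mono {A = A} (≤-reflexive (+-comm l 1))
    (within-trans {A = A} (reverse π) (edge⇒within {A = A} (edge-sym {A = A} e)))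

module _ (A : Structure m) (a : Vec (Carrier A) n) where

  inBall-lookup : ∀ i → InBall A r a (lookup a i)
  inBall-lookup i = i , within-refl

  inBall-mono : ∀ {x} → p ≤ q → InBall A p a x → InBall A q a x
  inBall-mono p≤q (i , w) = i , within-mono p≤q w

  inBall-step : ∀ {x y} → InBall A p a x → Within A q x y → InBall A (p + q) a y
  inBall-step (i , w) w′ = i , within-trans w w′

-- Partial isomorphisms between neighbourhoods

-- A relational form of BallIso.  The relation may extend beyond the r-balls,
-- which makes restriction to smaller balls the identity.
record LocalIso (r : ℕ) (A B : Structure m)
                (a : Vec (Carrier A) n) (b : Vec (Carrier B) n) : Set₁ where
  infix 4 _~_
  field
    _~_     : Carrier A → Carrier B → Set
    forth   : ∀ {x} → InBall A r a x → ∃[ y ] x ~ y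
    back    : ∀ {y} → InBall B r b y → ∃[ x ] x ~ y
    resp-≡  : ∀ {x x′ y y′} → x ~ y → x′ ~ y′ → x ≡ x′ ⇔ y ≡ y′
    resp-fn : ∀ i {x x′ y y′} → x ~ y → x′ ~ y′ → fn A i x ≡ x′ ⇔ fn B i y ≡ y′
    tuple   : ∀ j → lookup a j ~ lookup b j

module _ {A B : Structure m} {a : Vec (Carrier A) n} {b : Vec (Carrier B) n} where

  converse : LocalIso r A B a b → LocalIso r B A b a
  converse h = record
    { _~_     = λ y x → x ~ y
    ; forth   = back
    ; back    = forth
    ; resp-≡  = λ s t → ⇔-sym (resp-≡ s t)
    ; resp-fn = λ i s t → ⇔-sym (resp-fn i s t)
    ; tuple   = tuple
    } where open LocalIso h

  -- The relation carries its own proof of membership in the ball. Since `Ball` compares points by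
  -- their carrier alone, different proofs for one point give the same image, and the inverse gives
  -- injectivity.
  ballIso⇒localIso : BallIso r A B a b → LocalIso r A B a b
  ballIso⇒localIso {r = r} h = record
    { _~_     = λ x y → Σ (InBall A r a x) λ x∈ → BallIso.to h (x , x∈) ≡ y
    ; forth   = λ x∈ → _ , x∈ , refl
    ; back    = λ {y} y∈ → proj₁ (Inverse.from f (y , y∈)) , proj₂ (Inverse.from f (y , y∈)) ,
                           Inverse.strictlyInverseˡ f (y , y∈)
    ; resp-≡  = λ { {x} {x′} (x∈ , refl) (x′∈ , refl) → mk⇔
        (Inverse.to-cong f {x , x∈} {x′ , x′∈})
        (λ e → trans (sym (Inverse.strictlyInverseʳ f (x , x∈)))
                 (trans (Inverse.from-cong f {Inverse.to f (x , x∈)} {Inverse.to f (x′ , x′∈)} e)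
                   (Inverse.strictlyInverseʳ f (x′ , x′∈)))) }
    ; resp-fn = λ { i {x} {x′} (x∈ , refl) (x′∈ , refl) →
                    BallIso.preserves h i (x , x∈) (x′ , x′∈) }
    ; tuple   = λ j → inBall-lookup A a j , BallIso.tuple h j (_ , inBall-lookup A a j) refl
    } where f = BallIso.bijection h

module _ {A B : Structure m} {a : Vec (Carrier A) n} {b : Vec (Carrier B) n} (h : LocalIso r A B a b) where
  open LocalIso h

  -- A path of length l from a point of the p-ball stays in the ball of radius p + l, so each vertex
  -- has a partner and `resp-fn` carries each edge.
  follow : ∀ {x x′ y} → x ~ y → InBall A p a x → p + l ≤ r → Path A l x x′ →
           ∃[ y′ ] (x′ ~ y′ × Path B l y y′)
  follow s _ _ [] = _ , s , []
  follow {p = p} {l = suc l} s x∈ p+l≤r (e@(i , e′) ∷ π) =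
    let z∈         = inBall-step A a x∈ (edge⇒within {A = A} e)
        1+p+l≤r    = ≤-trans (≤-reflexive (+-assoc p 1 l)) p+l≤r
        y₁ , t     = forth (inBall-mono A a (≤-trans (m≤m+n (p + 1) l) 1+p+l≤r) z∈)
        y′ , t′ , π′ = follow t z∈ 1+p+l≤r π
    in y′ , t′ , (i , Sum.map (to (resp-fn i s t)) (to (resp-fn i t s)) e′) ∷ π′

  -- The transported path ends at some partner of `x′`, and `resp-≡` identifies it with `y′`.
  transfer-within : ∀ {x x′ y y′} → x ~ y → x′ ~ y′ → InBall A p a x → p + q ≤ r →
                    Within A q x x′ → Within B q y y′
  transfer-within {p = p} s t x∈ p+q≤r (l , l≤q , π)
    with z , t′ , π′ ← follow s x∈ (≤-trans (+-monoʳ-≤ p l≤q) p+q≤r) π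
    with refl ← to (resp-≡ t′ t) refl = l , l≤q , π′

  transfer-ball : ∀ {x y} → x ~ y → p ≤ r → InBall A p a x → InBall B p b y
  -- The path starts at a centre, which lies in its own ball of radius 0, so all of r is available
  -- for its length.
  transfer-ball s p≤r (i , w) = i , transfer-within (tuple i) s (inBall-lookup A a {r = 0} i) p≤r w

restrict : {A B : Structure m} {a : Vec (Carrier A) n} {b : Vec (Carrier B) n} →
           LocalIso r A B a b → q ≤ r → LocalIso q A B a b
restrict {A = A} {B} {a} {b} h q≤r = record
  { LocalIso h
  ; forth = LocalIso.forth h ∘ inBall-mono A a q≤r
  ; back  = LocalIso.back h ∘ inBall-mono B b q≤r
  }

-- The q-balls around `a′` lie in the ball of radius p + q around `a`. On the other side `b′` lies
-- in the p-ball of `b` by transfer, so the same inclusion holds there.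
recentre : {A B : Structure m} {a : Vec (Carrier A) n} {b : Vec (Carrier B) n} (h : LocalIso r A B a b) →
           {a′ : Vec (Carrier A) k} {b′ : Vec (Carrier B) k} →
           (∀ j → LocalIso._~_ h (lookup a′ j) (lookup b′ j)) →
           (∀ j → InBall A p a (lookup a′ j)) → p + q ≤ r → LocalIso q A B a′ b′
recentre {p = p} {q = q} {A = A} {B = B} {a} {b} h t a′∈ p+q≤r = record
  { _~_     = _~_
  ; forth   = λ (j , w) → forth (inBall-mono A a p+q≤r (inBall-step A a (a′∈ j) w))
  ; back    = λ (j , w) → back (inBall-mono B b p+q≤r
                (inBall-step B b (transfer-ball h (t j) (≤-trans (m≤m+n p q) p+q≤r) (a′∈ j)) w))
  ; resp-≡  = resp-≡
  ; resp-fn = resp-fn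
  ; tuple   = t
  } where open LocalIso h

localIso-refl : {a : Vec (Carrier A) n} → LocalIso r A A a a
localIso-refl = record
  { _~_     = _≡_
  ; forth   = λ _ → _ , refl
  ; back    = λ _ → _ , refl
  ; resp-≡  = λ { refl refl → mk⇔ (λ e → e) (λ e → e) }
  ; resp-fn = λ { i refl refl → mk⇔ (λ e → e) (λ e → e) }
  ; tuple   = λ _ → refl
  }

-- The empty tuple has empty balls; for sentences the condition on balls is therefore vacuous.
localIso-[] : {A B : Structure m} → LocalIso r A B [] []
localIso-[] = record
  { _~_     = λ _ _ → ⊥
  ; forth   = λ ()
  ; back    = λ ()
  ; resp-≡  = λ ()
  ; resp-fn = λ _ ()
  ; tuple   = λ ()
  }

localIso-trans : {A B D : Structure m} {a : Vec (Carrier A) n} {b : Vec (Carrier B) n} {d : Vec (Carrier D) n} →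
                 LocalIso r A B a b → LocalIso r B D b d → LocalIso r A D a d
localIso-trans h g = record
  { _~_     = λ x z → ∃[ y ] (x H.~ y × y G.~ z)
  ; forth   = λ x∈ → let y , s = H.forth x∈
                         -- The intermediate point lies in the r-ball of `b`, where the second
                         -- isomorphism is known to be defined.
                         z , t = G.forth (transfer-ball h s ≤-refl x∈)
                     in z , y , s , t
  ; back    = λ z∈ → let y , t = G.back z∈
                         x , s = H.back (transfer-ball (converse g) t ≤-refl z∈)
                     in x , y , s , t
  ; resp-≡  = λ (_ , s , t) (_ , s′ , t′) → G.resp-≡ t t′ ⇔-∘ H.resp-≡ s s′
  ; resp-fn = λ i (_ , s , t) (_ , s′ , t′) → G.resp-fn i t t′ ⇔-∘ H.resp-fn i s s′
  ; tuple   = λ j → _ , H.tuple j , G.tuple j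
  }
  where
  module H = LocalIso h
  module G = LocalIso g

-- The distance hypotheses exclude both overlaps and edges between the two balls,
-- so the union of the two ball isomorphisms is again one.
glue : {A B : Structure m} {a : Vec (Carrier A) n} {b : Vec (Carrier B) n} {x : Carrier A} {y : Carrier B} →
       LocalIso r A B a b → LocalIso r A B (x ∷ []) (y ∷ []) →
       ¬ InBall A (r + suc r) a x → ¬ InBall B (r + suc r) b y →
       LocalIso r A B (x ∷ a) (y ∷ b)
glue {m = m} {r = r} {A = A} {B = B} {a = a} {b} {x} {y} h g x∉ y∉ = record
  { _~_     = _≈_
  ; forth   = λ { (zero  , w) → let v , t = G.forth (zero , w) in
                    v , inj₂ (t , (zero , w) , transfer-ball g t ≤-refl (zero , w))
                ; (suc i , w) → let v , t = H.forth (i , w) in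
                    v , inj₁ (t , (i , w) , transfer-ball h t ≤-refl (i , w)) }
  ; back    = λ { (zero  , w) → let v , t = G.back (zero , w) in
                    v , inj₂ (t , transfer-ball (converse g) t ≤-refl (zero , w) , (zero , w))
                ; (suc i , w) → let v , t = H.back (i , w) in
                    v , inj₁ (t , transfer-ball (converse h) t ≤-refl (i , w) , (i , w)) }
  ; resp-≡  = λ where
      (inj₁ (s , _)) (inj₁ (t , _)) → H.resp-≡ s t
      (inj₂ (s , _)) (inj₂ (t , _)) → G.resp-≡ s t
      (inj₁ (_ , u , v)) (inj₂ (_ , u′ , v′)) → mk⇔
        (λ { refl → ⊥-elim (apart A a x∉ u u′ within-refl) })
        (λ { refl → ⊥-elim (apart B b y∉ v v′ within-refl) })
      (inj₂ (_ , u′ , v′)) (inj₁ (_ , u , v)) → mk⇔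
        (λ { refl → ⊥-elim (apart A a x∉ u u′ within-refl) })
        (λ { refl → ⊥-elim (apart B b y∉ v v′ within-refl) })
  ; resp-fn = λ where
      i (inj₁ (s , _)) (inj₁ (t , _)) → H.resp-fn i s t
      i (inj₂ (s , _)) (inj₂ (t , _)) → G.resp-fn i s t
      i (inj₁ (_ , u , v)) (inj₂ (_ , u′ , v′)) → mk⇔
        (λ e → ⊥-elim (apart A a x∉ u u′ (edge⇒within (i , inj₁ e))))
        (λ e → ⊥-elim (apart B b y∉ v v′ (edge⇒within (i , inj₁ e))))
      i (inj₂ (_ , u′ , v′)) (inj₁ (_ , u , v)) → mk⇔
        (λ e → ⊥-elim (apart A a x∉ u u′ (edge⇒within (i , inj₂ e))))
        (λ e → ⊥-elim (apart B b y∉ v v′ (edge⇒within (i , inj₂ e))))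
  ; tuple   = λ where
      zero    → inj₂ (G.tuple zero , inBall-lookup A (x ∷ []) zero
                                   , inBall-lookup B (y ∷ []) zero)
      (suc j) → inj₁ (H.tuple j , inBall-lookup A a j , inBall-lookup B b j)
  }
  where
  module H = LocalIso h
  module G = LocalIso g

  -- Both relations may extend beyond their balls, so each is cut down to r-balls on both sides;
  -- `apart` then excludes every mixed pair.
  _≈_ : Carrier A → Carrier B → Set
  u ≈ v = (u H.~ v × InBall A r a u × InBall B r b v)
        ⊎ (u G.~ v × InBall A r (x ∷ []) u × InBall B r (y ∷ []) v)

  -- Otherwise z could be reached from `c` by r steps to u, one to v and r more, which is the
  -- excluded radius r + 1 + r.
  apart : ∀ (D : Structure m) {n} (c : Vec (Carrier D) n) {z u v} → ¬ InBall D (r + suc r) c z →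
          InBall D r c u → InBall D r (z ∷ []) v → ¬ Within D 1 u v
  apart D c z∉ u∈ (zero , w′) w = z∉
    (inBall-mono D c (≤-reflexive (+-assoc r 1 r))
      (inBall-step D c (inBall-step D c u∈ w) (within-sym {A = D} w′)))

-- Satisfaction

module _ (A : Structure m) where

  ⊨⋀ : ∀ (φs : List (Formula m n)) {a} → (A ⊨ ⋀ φs [ a ]) ⇔ All (λ φ → A ⊨ φ [ a ]) φs
  ⊨⋀ []       = mk⇔ (λ _ → []) (λ _ ())
  ⊨⋀ (φ ∷ φs) = mk⇔ (λ (h , hs) → h ∷ to (⊨⋀ φs) hs) (λ { (h ∷ hs) → h , from (⊨⋀ φs) hs })

  ⊨⋁ : ∀ (φs : List (Formula m n)) {a} → (A ⊨ ⋁ φs [ a ]) ⇔ Any (λ φ → A ⊨ φ [ a ]) φs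
  ⊨⋁ []       = mk⇔ (λ ()) (λ ())
  ⊨⋁ (φ ∷ φs) = mk⇔ (Sum.[ here , there ∘ to (⊨⋁ φs) ])
                     (λ { (here h) → inj₁ h ; (there h) → inj₂ (from (⊨⋁ φs) h) })

  ⊨⋀[] : ∀ k (φ : Fin k → Formula m n) {a} → (A ⊨ ⋀[ k ] φ [ a ]) ⇔ (∀ i → A ⊨ φ i [ a ])
  ⊨⋀[] k φ = mk⇔ (All.tabulate⁻ ∘ to (⊨⋀ (List.tabulate φ))) (from (⊨⋀ (List.tabulate φ)) ∘ All.tabulate⁺)

  ⊨⋁[] : ∀ k (φ : Fin k → Formula m n) {a} → (A ⊨ ⋁[ k ] φ [ a ]) ⇔ (∃[ i ] A ⊨ φ i [ a ])
  ⊨⋁[] k φ = mk⇔ (Any.tabulate⁻ ∘ to (⊨⋁ (List.tabulate φ)))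
                  (λ (i , h) → from (⊨⋁ (List.tabulate φ)) (Any.tabulate⁺ i h))

  ⟦renameTerm⟧ : ∀ (t : Term m n) {ρ : Fin n → Fin k} {a a′} → (∀ i → lookup a (ρ i) ≡ lookup a′ i) →
                 ⟦ renameTerm ρ t ⟧ A a ≡ ⟦ t ⟧ A a′
  ⟦renameTerm⟧ (var i)   e = e i
  ⟦renameTerm⟧ (fun i t) e = cong (fn A i) (⟦renameTerm⟧ t e)

  -- Environments are compared pointwise because this condition survives `lift` and so passes under
  -- quantifiers.
  ⊨rename : ∀ (φ : Formula m n) {ρ : Fin n → Fin k} {a a′} → (∀ i → lookup a (ρ i) ≡ lookup a′ i) →
            (A ⊨ rename ρ φ [ a ]) ⇔ (A ⊨ φ [ a′ ])
  ⊨rename (s ≐ t)  e = mk⇔ (λ h → trans (sym (⟦renameTerm⟧ s e)) (trans h (⟦renameTerm⟧ t e)))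
                            (λ h → trans (⟦renameTerm⟧ s e) (trans h (sym (⟦renameTerm⟧ t e))))
  ⊨rename ⊥′       e = mk⇔ (λ ()) (λ ())
  ⊨rename (φ ∧′ ψ) e = mk⇔ (Product.map (to (⊨rename φ e)) (to (⊨rename ψ e)))
                            (Product.map (from (⊨rename φ e)) (from (⊨rename ψ e)))
  ⊨rename (φ ∨′ ψ) e = mk⇔ (Sum.map (to (⊨rename φ e)) (to (⊨rename ψ e)))
                            (Sum.map (from (⊨rename φ e)) (from (⊨rename ψ e)))
  ⊨rename (φ ⇒′ ψ) e = mk⇔ (λ h → to (⊨rename ψ e) ∘ h ∘ from (⊨rename φ e))
                            (λ h → from (⊨rename ψ e) ∘ h ∘ to (⊨rename φ e))
  ⊨rename (∀′ φ)   e = mk⇔ (λ h x → to (⊨rename φ λ { zero → refl ; (suc i) → e i }) (h x))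
                            (λ h x → from (⊨rename φ λ { zero → refl ; (suc i) → e i }) (h x))
  ⊨rename (∃′ φ)   e = mk⇔ (Product.map₂ (to (⊨rename φ λ { zero → refl ; (suc i) → e i })))
                            (Product.map₂ (from (⊨rename φ λ { zero → refl ; (suc i) → e i })))

  ⊨weaken : ∀ (σ : Sentence m) {a : Vec (Carrier A) n} → (A ⊨ weaken σ [ a ]) ⇔ (A ⊨ σ)
  ⊨weaken σ = ⊨rename σ λ ()

  ⊨⟨⟩ : ∀ (α : Formula m 1) (v : Fin n) {a} → (A ⊨ α ⟨ v ⟩ [ a ]) ⇔ (A ⊨ α [ lookup a v ∷ [] ])
  ⊨⟨⟩ α v = ⊨rename α λ { zero → refl }

  ⊨∀*⁺ : ∀ n {φ : Formula m n} → (∀ a → A ⊨ φ [ a ]) → A ⊨ ∀* n φ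
  ⊨∀*⁺ zero    h = h []
  ⊨∀*⁺ (suc n) h = ⊨∀*⁺ n λ a x → h (x ∷ a)

  ⊨∃* : ∀ n (φ : Formula m n) → (A ⊨ ∃* n φ) ⇔ Σ (Vec (Carrier A) n) λ a → A ⊨ φ [ a ]
  ⊨∃* zero    φ = mk⇔ ([] ,_) (λ { ([] , h) → h })
  ⊨∃* (suc n) φ = mk⇔ (λ h → let a , x , h′ = to (⊨∃* n (∃′ φ)) h in x ∷ a , h′)
                       (λ { (x ∷ a , h) → from (⊨∃* n (∃′ φ)) (a , x , h) })

  ⊨edge : ∀ (x y : Fin n) {a} → (A ⊨ edge x y [ a ]) ⇔ Edge A (lookup a x) (lookup a y)
  ⊨edge x y = ⊨⋁[] _ _

  ⊨d≤ : ∀ r (x y : Fin n) {a} → (A ⊨ d≤ r x y [ a ]) ⇔ Within A r (lookup a x) (lookup a y)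
  ⊨d≤ zero    x y = mk⇔ ≡⇒within within-zero
  ⊨d≤ (suc r) x y = mk⇔
    (λ { (inj₁ e) → ≡⇒within e
       ; (inj₂ (z , e , h)) → let l , l≤r , π = to (⊨d≤ r zero (suc y)) h in
           suc l , s≤s l≤r , to (⊨edge (suc x) zero) e ∷ π })
    (Sum.map₂ (λ (z , e , w) → z , from (⊨edge (suc x) zero) e , from (⊨d≤ r zero (suc y)) w) ∘ within-suc)

  IsScattered : ℕ → (Fin k → Carrier A) → Set
  IsScattered r v = ∀ i (j : Fin′ i) → ¬ Within A r (v (inject j)) (v i)

  ⊨scattered : ∀ r s (α : Fin s → Formula m 1) → (A ⊨ scattered r s α) ⇔
    Σ (Vec (Carrier A) s) λ v → (∀ i → A ⊨ α i [ lookup v i ∷ [] ]) × IsScattered (2 * r) (lookup v)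
  ⊨scattered r s α = mk⇔
    (λ h → let v , hα , hd = to (⊨∃* s (types ∧′ distances)) h in
       v , (λ i → to (⊨⟨⟩ (α i) i) (to (⊨⋀[] s _) hα i))
         , (λ i j → to (⊨⋀[] _ (distance i)) (to (⊨⋀[] s _) hd i) j ∘ from (⊨d≤ (2 * r) (inject j) i)))
    (λ (v , hα , hd) → from (⊨∃* s (types ∧′ distances))
       (v , from (⊨⋀[] s _) (λ i → from (⊨⟨⟩ (α i) i) (hα i))
          , from (⊨⋀[] s _) (λ i → from (⊨⋀[] _ (distance i)) λ j → hd i j ∘ to (⊨d≤ (2 * r) (inject j) i))))
    where
    types distances : Formula m s
    types = ⋀[ s ] λ i → α i ⟨ i ⟩
    distance : (i : Fin s) → Fin′ i → Formula m s
    distance i j = d> (2 * r) (inject j) i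
    distances = ⋀[ s ] λ i → ⋀[ _ ] (distance i)

-- Finite enumerations and Boolean combinations

vectors : ∀ {X : Set} k → List X → List (Vec X k)
vectors zero    xs = [] ∷ []
vectors (suc k) xs = cartesianProductWith _∷_ xs (vectors k xs)

module _ {X : Set} {xs : List X} where

  ∈-vectors⁺ : ∀ {k} (v : Vec X k) → (∀ i → lookup v i ∈ xs) → v ∈ vectors k xs
  ∈-vectors⁺ []      h = here refl
  ∈-vectors⁺ (x ∷ v) h = ∈-cartesianProductWith⁺ _∷_ (h zero) (∈-vectors⁺ v (h ∘ suc))

  ∈-vectors⁻ : ∀ {k} (v : Vec X k) → v ∈ vectors k xs → ∀ i → lookup v i ∈ xs
  ∈-vectors⁻ {suc k} v v∈ i with ∈-cartesianProductWith⁻ _∷_ xs (vectors k xs) v∈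
  ∈-vectors⁻ v v∈ zero    | x , w , x∈ , w∈ , refl = x∈
  ∈-vectors⁻ v v∈ (suc i) | x , w , x∈ , w∈ , refl = ∈-vectors⁻ w w∈ i

-- Turns the strict inequality supplied by the pigeonhole principle into the `Fin′` index used by
-- `IsScattered`.
inject-surjective : ∀ {i j : Fin n} → i < j → ∃[ j′ ] inject {i = j} j′ ≡ i
inject-surjective {i = zero}  {suc j} _         = zero , refl
inject-surjective {i = suc i} {suc j} (s≤s i<j) = Product.map suc (cong suc) (inject-surjective i<j)

Agree : List (Sentence m) → Structure m → Structure m → Set
Agree S A B = All (λ σ → (A ⊨ σ) ⇔ (B ⊨ σ)) S

agree-sym : ∀ {S : List (Sentence m)} {A B} → Agree S A B → Agree S B A
agree-sym = All.map ⇔-sym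

module _ {G : Pred (Formula m n) 0ℓ} where

  ⋁-boolean : ∀ {φs} → All (BooleanCombination G) φs → BooleanCombination G (⋁ φs)
  ⋁-boolean []       = bot
  ⋁-boolean (h ∷ hs) = disj h (⋁-boolean hs)

  ⋀-boolean : ∀ {φs} → All (BooleanCombination G) φs → BooleanCombination G (⋀ φs)
  ⋀-boolean []       = neg bot
  ⋀-boolean (h ∷ hs) = conj h (⋀-boolean hs)

module _ {C : Choice m} where

  literal-boolean : ∀ {β} → Literal C β → BooleanCombination (LocalSentence C) β
  literal-boolean (pos h) = gen h
  literal-boolean (neg h) = neg (gen h)

  -- Renaming commutes with the Boolean connectives by definition, so only the generators change.
  weaken-boolean : ∀ {σ} → BooleanCombination (LocalSentence C) σ →
                   BooleanCombination (Local C) (weaken {n = n} σ)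
  weaken-boolean (gen h)    = gen (sentence h)
  weaken-boolean bot        = bot
  weaken-boolean (neg h)    = neg (weaken-boolean h)
  weaken-boolean (conj h g) = conj (weaken-boolean h) (weaken-boolean g)
  weaken-boolean (disj h g) = disj (weaken-boolean h) (weaken-boolean g)

  disjunct-boolean : ∀ {ψ : Formula m n} → Disjunct C ψ → BooleanCombination (Local C) ψ
  disjunct-boolean (disjunct α hs) =
    conj (gen (formula α)) (weaken-boolean (⋀-boolean (All.map literal-boolean hs)))

module Locality {m : ℕ} {V : Variety m} {C : Choice m} (adm : Admissible V C)
                (em₁ : ExcludedMiddle (lsuc 0ℓ)) where
  open Admissible adm

  -- The larger level serves statements that quantify over structures or relations, such as
  -- consistency of a cell or existence of a local isomorphism.
  em : ExcludedMiddle 0ℓ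
  em {P} = map′ Level.lower Level.lift (em₁ {Lift (lsuc 0ℓ) P})

  -- Transfer of scattered sets by local sentences

  scatteredOfSize : ℕ → ℕ → List (Sentence m)
  scatteredOfSize r k = map (λ αs → scattered r (suc k) (lookup αs)) (vectors (suc k) (C r 1))

  -- Each k below s stands for k + 1 points, so the sizes run from 1 to s.
  scatteredSentences : ℕ → ℕ → List (Sentence m)
  scatteredSentences r s = concatMap (scatteredOfSize r) (upTo s)

  scatteredSentences-local : ∀ r s → All (LocalSentence C) (scatteredSentences r s)
  scatteredSentences-local r s = All.tabulate λ {σ} σ∈ → go (find (∈-concatMap⁻ _ {upTo s} σ∈))
    where
    go : ∀ {σ} → ∃[ k ] (k ∈ upTo s × σ ∈ scatteredOfSize r k) → LocalSentence C σ
    go (k , _ , σ∈) with αs , αs∈ , refl ← ∈-map⁻ _ σ∈ = scatteredᴸ r k (lookup αs) (∈-vectors⁻ αs αs∈)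

  ∈-scatteredSentences : ∀ {r s k} (αs : Vec (Formula m 1) (suc k)) → k ℕ.< s → (∀ i → lookup αs i ∈ C r 1) →
                         scattered r (suc k) (lookup αs) ∈ scatteredSentences r s
  ∈-scatteredSentences αs k<s αs∈ = ∈-concatMap⁺ _ (lose (∈-upTo⁺ k<s) (∈-map⁺ _ (∈-vectors⁺ αs αs∈)))

  -- The formulas of `C r 1` satisfied by the points of `v` make up a scattered sentence true in A,
  -- hence in B. Its witnesses in B satisfy the same formulas, and `iso` matches their balls.
  transfer-scattered : ∀ {A B r s} → A ∈ᵛ V → B ∈ᵛ V → Agree (scatteredSentences r s) A B →
    ∀ {k} → k ℕ.< s → (v : Fin (suc k) → Carrier A) → IsScattered A (2 * r) v →
    Σ (Fin (suc k) → Carrier B) λ w →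
      IsScattered B (2 * r) w × (∀ i → LocalIso r A B (v i ∷ []) (w i ∷ []))
  transfer-scattered {A} {B} {r} A∈ B∈ agree {k} k<s v v-scattered =
    lookup w , w-scattered , λ i →
      ballIso⇒localIso (iso r 1 A B A∈ B∈ _ _ (α i) (α∈ i) (A⊨α i)
        (subst (λ β → B ⊨ β [ lookup w i ∷ [] ]) (lookup∘tabulate α i) (B⊨α i)))
    where
    α : Fin (suc k) → Formula m 1
    α i = proj₁ (unique r 1 A A∈ (v i ∷ []))
    α∈ : ∀ i → α i ∈ C r 1
    α∈ i = proj₁ (proj₁ (proj₂ (unique r 1 A A∈ (v i ∷ []))))
    A⊨α : ∀ i → A ⊨ α i [ v i ∷ [] ]
    A⊨α i = proj₂ (proj₁ (proj₂ (unique r 1 A A∈ (v i ∷ []))))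
    -- The enumerated sentences are indexed by vectors, and `lookup αs` agrees with `α` only
    -- pointwise; hence the substitutions below.
    αs = tabulate α
    A⊨ : A ⊨ scattered r (suc k) (lookup αs)
    A⊨ = from (⊨scattered A r (suc k) (lookup αs))
      ( tabulate v
      , (λ i → subst (λ β → A ⊨ β [ lookup (tabulate v) i ∷ [] ]) (sym (lookup∘tabulate α i))
                 (subst (λ x → A ⊨ α i [ x ∷ [] ]) (sym (lookup∘tabulate v i)) (A⊨α i)))
      , λ i j d → v-scattered i j
          (subst (λ x → Within A (2 * r) x (v i)) (lookup∘tabulate v (inject j))
            (subst (Within A (2 * r) _) (lookup∘tabulate v i) d)))
    B⊨ = to (⊨scattered B r (suc k) (lookup αs)) (to (All.lookup agree
           (∈-scatteredSentences αs k<s λ i → subst (_∈ C r 1) (sym (lookup∘tabulate α i)) (α∈ i))) A⊨)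
    w = proj₁ B⊨
    B⊨α = proj₁ (proj₂ B⊨)
    w-scattered = proj₂ (proj₂ B⊨)

  -- At distance more than copyRadius r, r-balls are disjoint and without edges
  -- between them.
  copyRadius nearRadius : ℕ → ℕ
  copyRadius r = r + suc r
  -- A point farther than this from a is at distance more than 2 * copyRadius r
  -- from every point of the copyRadius-ball around a.
  nearRadius r = copyRadius r + 2 * copyRadius r

  -- Extending a local isomorphism by one point

  module Extension {n r : ℕ} {A B : Structure m} (A∈ : A ∈ᵛ V) (B∈ : B ∈ᵛ V)
                   {a : Vec (Carrier A) n} {b : Vec (Carrier B) n} where

    private
      R near : ℕ
      R = copyRadius r
      near = nearRadius r

    R+R≡2*R : R + R ≡ 2 * R
    R+R≡2*R = cong (R +_) (sym (+-identityʳ R))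

    near≤ : near ≤ near + r
    near≤ = m≤m+n near r

    R+R≤ : R + R ≤ near + r
    R+R≤ = ≤-trans (≤-trans (≤-reflexive R+R≡2*R) (m≤n+m (2 * R) R)) near≤

    R≤ : R ≤ near + r
    R≤ = ≤-trans (m≤m+n R R) R+R≤

    module _ (h : LocalIso (near + r) A B a b) (agree : Agree (scatteredSentences R (suc n)) A B)
             (x : Carrier A) where
      open LocalIso h

      -- The r-ball of a point within `near` of `a` lies in the ball of radius `near + r`, so the
      -- partner of x under `h` serves as y.
      extend-near : InBall A near a x → ∃[ y ] LocalIso r A B (x ∷ a) (y ∷ b)
      extend-near x∈ = y , recentre h
          (λ { zero → x~y ; (suc j) → tuple j })
          (λ { zero → x∈ ; (suc j) → inBall-lookup A a j })
          ≤-refl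
        where
        y = proj₁ (forth (inBall-mono A a near≤ x∈))
        x~y = proj₂ (forth (inBall-mono A a near≤ x∈))

      -- The radius is R because a local sentence ties the radius of its types to half the
      -- separation, and the pigeonhole argument calls for separation 2R.
      Copy : Carrier B → Set₁
      Copy y = LocalIso R A B (x ∷ []) (y ∷ [])

      module _ (x∉ : ¬ InBall A near a x) (copies-close : ∀ y → Copy y → InBall B R b y) where

        -- The copies of x in B lie near b, so they pull back to A; x is far from
        -- all of them, and enlarges the scattered set there.
        grow : (w : Fin k → Carrier B) → IsScattered B (2 * R) w → (∀ i → Copy (w i)) → k ℕ.< suc n →
               Σ (Fin (suc k) → Carrier B) λ w′ → IsScattered B (2 * R) w′ × (∀ i → Copy (w′ i))
        grow {k} w w-scattered copy k<1+n =
          let w′ , w′-scattered , v≅w′ = transfer-scattered A∈ B∈ agree k<1+n v v-scattered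
          in w′ , w′-scattered , λ i → localIso-trans (x≅v i) (v≅w′ i)
          where
          w∈ : ∀ i → InBall B R b (w i)
          w∈ i = copies-close (w i) (copy i)

          u : Fin k → Carrier A
          u i = proj₁ (back (inBall-mono B b R≤ (w∈ i)))
          u~w : ∀ i → u i ~ w i
          u~w i = proj₂ (back (inBall-mono B b R≤ (w∈ i)))
          u∈ : ∀ i → InBall A R a (u i)
          u∈ i = transfer-ball (converse h) (u~w i) R≤ (w∈ i)

          v : Fin (suc k) → Carrier A
          v = x F.∷ u

          v-scattered : IsScattered A (2 * R) v
          v-scattered (suc i) zero    d = x∉ (inBall-step A a (u∈ i) (within-sym d))
          -- A path of length 2R from a point of the R-ball stays within R + 2R of `a`, hence in the
          -- domain of `h`, and would bring two points of `w` together.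
          v-scattered (suc i) (suc j) d = w-scattered i j
            (transfer-within h (u~w (inject j)) (u~w i) (u∈ (inject j)) near≤ d)

          x≅v : ∀ i → LocalIso R A A (x ∷ []) (v i ∷ [])
          x≅v zero    = localIso-refl
          -- Via `w i`, a copy of x whose R-ball lies within R + R of `b` and is carried back to
          -- that of `u i`. So the transferred points are again copies of x.
          x≅v (suc i) = localIso-trans (copy i)
            (recentre (converse h) (λ { zero → u~w i }) (λ { zero → w∈ i }) R+R≤)

        -- Each stage replaces the whole set by a transferred one. The last stage transfers n + 1
        -- points, whence agreement on sizes up to `suc n`.
        scattered-copies : ∀ k → k ≤ suc n →
          Σ (Fin k → Carrier B) λ w → IsScattered B (2 * R) w × (∀ i → Copy (w i))
        scattered-copies zero    _   = (λ ()) , (λ ()) , (λ ())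
        scattered-copies (suc k) k<1+n =
          let w , w-scattered , copy = scattered-copies k (<⇒≤ k<1+n) in grow w w-scattered copy k<1+n

        -- A ball of radius R contains at most one point of a 2R-scattered set.
        copies-not-close : ⊥
        copies-not-close =
          let w , w-scattered , copy = scattered-copies (suc n) ≤-refl
              centre i = proj₁ (copies-close (w i) (copy i))
              close i = proj₂ (copies-close (w i) (copy i))
              i , j , i<j , same = pigeonhole ≤-refl centre
              j′ , j′≡i = inject-surjective i<j
              d = subst (λ c → Within B R (lookup b c) (w j)) (sym same) (close j)
          in w-scattered j j′ (subst (λ i → Within B (2 * R) (w i) (w j)) (sym j′≡i)
               (within-mono (≤-reflexive R+R≡2*R) (within-trans (within-sym (close i)) d)))

      extend : ∃[ y ] LocalIso r A B (x ∷ a) (y ∷ b)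
      extend with em {InBall A near a x}
      ... | yes x∈ = extend-near x∈
      ... | no x∉ with em₁ {∃[ y ] (Copy y × ¬ InBall B R b y)}
      -- R is the distance r + 1 + r that `glue` asks for on both sides; on the A side it is below
      -- `near`.
      ...   | yes (y , g , y∉) = y , glue (restrict h (m≤n+m r near)) (restrict g (m≤m+n r (suc r)))
                                   (x∉ ∘ inBall-mono A a (m≤m+n R (2 * R))) y∉
      ...   | no ¬far = ⊥-elim (copies-not-close x∉ λ y g →
                decidable-stable em λ y∉ → ¬far (y , g , y∉))

  -- Every formula is locally determined

  -- Preservation is stated in one direction; the other follows by exchanging A and B, as both
  -- agreement and local isomorphism are symmetric.
  record LocallyDetermined {n} (φ : Formula m n) : Set₁ where
    field
      radius    : ℕ
      sentences : List (Sentence m)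
      local     : All (LocalSentence C) sentences
      preserves : ∀ {A B} → A ∈ᵛ V → B ∈ᵛ V → Agree sentences A B →
                  ∀ {a b} → LocalIso radius A B a b → A ⊨ φ [ a ] → B ⊨ φ [ b ]

  open LocallyDetermined

  depth : Term m n → ℕ
  depth (var i)   = 0
  depth (fun i t) = suc (depth t)

  term-inBall : ∀ (A : Structure m) {a} (t : Term m n) → InBall A (depth t) a (⟦ t ⟧ A a)
  term-inBall A {a} (var i)   = inBall-lookup A a i
  term-inBall A {a} (fun i t) = inBall-mono A a (≤-reflexive (+-comm (depth t) 1))
    (inBall-step A a (term-inBall A t) (edge⇒within (i , inj₁ refl)))

  -- The value of t lies within `depth t` of `a`, so it has a partner, which `resp-fn` forces to be
  -- the value in B.
  ~-term : ∀ {A B a b} (h : LocalIso r A B a b) (t : Term m n) → depth t ≤ r →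
           LocalIso._~_ h (⟦ t ⟧ A a) (⟦ t ⟧ B b)
  ~-term h (var i) _ = LocalIso.tuple h i
  ~-term {A = A} {a = a} h (fun i t) d≤r
    with _ , s ← LocalIso.forth h (inBall-mono A a d≤r (term-inBall A (fun i t)))
    with refl ← to (LocalIso.resp-fn h i (~-term h t (<⇒≤ d≤r)) s) refl = s

  ≐-determined : (s t : Term m n) → LocallyDetermined (s ≐ t)
  ≐-determined s t = record
    { radius    = depth s ⊔ depth t
    ; sentences = []
    ; local     = []
    ; preserves = λ _ _ _ h → to (LocalIso.resp-≡ h (~-term h s (m≤m⊔n _ _)) (~-term h t (m≤n⊔m (depth s) _)))
    }

  -- `combine` receives equivalences because an implication uses its premise contravariantly.
  connective-determined : {φ ψ χ : Formula m n} →
    (∀ {A B a b} → (A ⊨ φ [ a ]) ⇔ (B ⊨ φ [ b ]) → (A ⊨ ψ [ a ]) ⇔ (B ⊨ ψ [ b ]) → A ⊨ χ [ a ] → B ⊨ χ [ b ]) →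
    LocallyDetermined φ → LocallyDetermined ψ → LocallyDetermined χ
  connective-determined combine dφ dψ = record
    { radius    = radius dφ ⊔ radius dψ
    ; sentences = sentences dφ ++ sentences dψ
    ; local     = All.++⁺ (local dφ) (local dψ)
    ; preserves = λ A∈ B∈ agree h → combine
        (iff dφ A∈ B∈ (All.++⁻ˡ _ agree) (restrict h (m≤m⊔n _ _)))
        (iff dψ A∈ B∈ (All.++⁻ʳ (sentences dφ) agree) (restrict h (m≤n⊔m (radius dφ) _)))
    }
    where
    iff : ∀ {φ : Formula m n} (d : LocallyDetermined φ) {A B} → A ∈ᵛ V → B ∈ᵛ V → Agree (sentences d) A B →
          ∀ {a b} → LocalIso (radius d) A B a b → (A ⊨ φ [ a ]) ⇔ (B ⊨ φ [ b ])
    iff d A∈ B∈ agree h = mk⇔ (preserves d A∈ B∈ agree h) (preserves d B∈ A∈ (agree-sym agree) (converse h))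

  module _ {φ : Formula m (suc n)} (d : LocallyDetermined φ) where

    -- `combine` receives the back-and-forth property at the radius of φ: the existential quantifier
    -- uses forth, the universal one back. Back is the extension step with A and B exchanged.
    quantifier-determined : {χ : Formula m n} →
      (∀ {A B a b} → (∀ x → ∃[ y ] (A ⊨ φ [ x ∷ a ] → B ⊨ φ [ y ∷ b ])) →
                     (∀ y → ∃[ x ] (A ⊨ φ [ x ∷ a ] → B ⊨ φ [ y ∷ b ])) → A ⊨ χ [ a ] → B ⊨ χ [ b ]) →
      LocallyDetermined χ
    quantifier-determined combine = record
      { radius    = nearRadius (radius d) + radius d
      ; sentences = sentences d ++ scatteredSentences (copyRadius (radius d)) (suc n)
      ; local     = All.++⁺ (local d) (scatteredSentences-local (copyRadius (radius d)) (suc n))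
      ; preserves = λ A∈ B∈ agree h →
          let agree₁ = All.++⁻ˡ _ agree
              agree₂ = All.++⁻ʳ (sentences d) agree
          in combine
            (λ x → let y , g = Extension.extend A∈ B∈ h agree₂ x in y , preserves d A∈ B∈ agree₁ g)
            (λ y → let x , g = Extension.extend B∈ A∈ (converse h) (agree-sym agree₂) y in
                   x , preserves d A∈ B∈ agree₁ (converse g))
      }

  locally-determined : (φ : Formula m n) → LocallyDetermined φ
  locally-determined (s ≐ t)  = ≐-determined s t
  locally-determined ⊥′       = record { radius = 0 ; sentences = [] ; local = [] ; preserves = λ _ _ _ _ () }
  locally-determined (φ ∧′ ψ) = connective-determined (λ e e′ → Product.map (to e) (to e′))
                                  (locally-determined φ) (locally-determined ψ)
  locally-determined (φ ∨′ ψ) = connective-determined (λ e e′ → Sum.map (to e) (to e′))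
                                  (locally-determined φ) (locally-determined ψ)
  locally-determined (φ ⇒′ ψ) = connective-determined (λ e e′ f → to e′ ∘ f ∘ from e)
                                  (locally-determined φ) (locally-determined ψ)
  locally-determined (∀′ φ)   = quantifier-determined (locally-determined φ)
                                  λ _ back f y → let x , g = back y in g (f x)
  locally-determined (∃′ φ)   = quantifier-determined (locally-determined φ)
                                  λ forth _ (x , p) → let y , g = forth x in y , g p

  -- Normal forms

  -- The disjunction runs over the members of L consistent with φ. Every tuple satisfies some
  -- member, and one tuple satisfying both a member and φ makes φ hold wherever that member does.
  definable : (L : List (Formula m n)) (φ : Formula m n) →
    (∀ A → A ∈ᵛ V → ∀ a → ∃[ ψ ] (ψ ∈ L × (A ⊨ ψ [ a ]))) →
    (∀ {ψ} → ψ ∈ L → ∀ {A B a b} → A ∈ᵛ V → B ∈ᵛ V →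
       A ⊨ ψ [ a ] → B ⊨ ψ [ b ] → A ⊨ φ [ a ] → B ⊨ φ [ b ]) →
    ∃[ ψs ] ((∀ {ψ} → ψ ∈ ψs → ψ ∈ L) × EquivalentOver V φ (⋁ ψs))
  definable {n} L φ covers decides =
    filter consistent? L , proj₁ ∘ ∈-filter⁻ consistent? {xs = L} , λ A A∈ → ⊨∀*⁺ A n λ a →
      (λ p → let ψ , ψ∈ , q = covers A A∈ a in
         from (⊨⋁ A _) (lose (∈-filter⁺ consistent? ψ∈ (A , A∈ , a , q , p)) q)) ,
      (λ p → let ψ , ψ∈′ , q = find (to (⊨⋁ A _) p)
                 ψ∈ , B , B∈ , b , q′ , p′ = ∈-filter⁻ consistent? {xs = L} ψ∈′
             in decides ψ∈ B∈ A∈ q′ q p′)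
    where
    Consistent : Formula m n → Set₁
    Consistent ψ = Σ (Structure m) λ A → A ∈ᵛ V × Σ (Vec (Carrier A) n) λ a → A ⊨ ψ [ a ] × A ⊨ φ [ a ]

    consistent? : ∀ ψ → Dec (Consistent ψ)
    consistent? ψ = em₁

  truthAssignments : List (Sentence m) → List (List (Sentence m))
  truthAssignments []      = [] ∷ []
  truthAssignments (σ ∷ S) = map (σ ∷_) (truthAssignments S) ++ map (¬′ σ ∷_) (truthAssignments S)

  truthAssignments-cover : ∀ A S → ∃[ βs ] (βs ∈ truthAssignments S × All (A ⊨_) βs)
  truthAssignments-cover A []      = [] , here refl , []
  truthAssignments-cover A (σ ∷ S) with truthAssignments-cover A S | em {A ⊨ σ}
  ... | βs , βs∈ , p | yes q = σ ∷ βs , ∈-++⁺ˡ (∈-map⁺ _ βs∈) , q ∷ p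
  ... | βs , βs∈ , p | no ¬q = ¬′ σ ∷ βs , ∈-++⁺ʳ (map (σ ∷_) (truthAssignments S)) (∈-map⁺ _ βs∈) , ¬q ∷ p

  truthAssignments-literals : ∀ {S βs} → All (LocalSentence C) S → βs ∈ truthAssignments S → All (Literal C) βs
  truthAssignments-literals []       (here refl) = []
  truthAssignments-literals {σ ∷ S} (h ∷ hs) βs∈ with ∈-++⁻ (map (σ ∷_) (truthAssignments S)) βs∈
  ... | inj₁ βs∈ with _ , βs∈ , refl ← ∈-map⁻ _ βs∈ = pos h ∷ truthAssignments-literals hs βs∈
  ... | inj₂ βs∈ with _ , βs∈ , refl ← ∈-map⁻ _ βs∈ = neg h ∷ truthAssignments-literals hs βs∈

  truthAssignments-agree : ∀ {A B} S {βs} → βs ∈ truthAssignments S → All (A ⊨_) βs → All (B ⊨_) βs → Agree S A B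
  truthAssignments-agree []      _ _ _ = []
  truthAssignments-agree (σ ∷ S) βs∈ p q with ∈-++⁻ (map (σ ∷_) (truthAssignments S)) βs∈
  ... | inj₁ βs∈ with _ , βs∈ , refl ← ∈-map⁻ _ βs∈ | p₀ ∷ p ← p | q₀ ∷ q ← q =
    mk⇔ (λ _ → q₀) (λ _ → p₀) ∷ truthAssignments-agree S βs∈ p q
  ... | inj₂ βs∈ with _ , βs∈ , refl ← ∈-map⁻ _ βs∈ | p₀ ∷ p ← p | q₀ ∷ q ← q =
    mk⇔ (⊥-elim ∘ p₀) (⊥-elim ∘ q₀) ∷ truthAssignments-agree S βs∈ p q

  -- Balls around the empty tuple are empty, so truth assignments alone decide φ.
  sentence-normalForm : (φ : Sentence m) →
    ∃[ φ* ] (BooleanCombination (LocalSentence C) φ* × EquivalentOver V φ φ*)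
  sentence-normalForm φ =
    let ψs , ψs⊆ , φ⇔ = definable cells φ covers decides
    in ⋁ ψs , ⋁-boolean (All.tabulate (cell-boolean ∘ ψs⊆)) , φ⇔
    where
    d = locally-determined φ
    S = sentences d
    cells = map ⋀ (truthAssignments S)

    covers : ∀ A → A ∈ᵛ V → ∀ a → ∃[ ψ ] (ψ ∈ cells × (A ⊨ ψ [ a ]))
    covers A A∈ [] = let βs , βs∈ , p = truthAssignments-cover A S in
      ⋀ βs , ∈-map⁺ ⋀ βs∈ , from (⊨⋀ A βs) p

    decides : ∀ {ψ} → ψ ∈ cells → ∀ {A B a b} → A ∈ᵛ V → B ∈ᵛ V →
              A ⊨ ψ [ a ] → B ⊨ ψ [ b ] → A ⊨ φ [ a ] → B ⊨ φ [ b ]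
    decides ψ∈ {A} {B} {[]} {[]} A∈ B∈ p q with βs , βs∈ , refl ← ∈-map⁻ ⋀ ψ∈ =
      preserves d A∈ B∈ (truthAssignments-agree S βs∈ (to (⊨⋀ A βs) p) (to (⊨⋀ B βs) q)) localIso-[]

    cell-boolean : ∀ {ψ} → ψ ∈ cells → BooleanCombination (LocalSentence C) ψ
    cell-boolean ψ∈ with βs , βs∈ , refl ← ∈-map⁻ ⋀ ψ∈ =
      ⋀-boolean (All.map literal-boolean (truthAssignments-literals (local d) βs∈))

  -- A shared formula of `C (radius d) n` yields the ball isomorphism and a shared truth assignment
  -- the agreement, so each cell decides φ.
  formula-normalForm : (φ : Formula m n) →
    ∃[ φ* ] (BooleanCombination (Local C) φ* × NormalForm C φ* × EquivalentOver V φ φ*)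
  formula-normalForm {n} φ =
    let ψs , ψs⊆ , φ⇔ = definable cells φ covers decides
        disjuncts = All.tabulate (cell-disjunct ∘ ψs⊆)
    in ⋁ ψs , ⋁-boolean (All.map disjunct-boolean disjuncts) , (ψs , disjuncts , refl) , φ⇔
    where
    d = locally-determined φ
    S = sentences d
    cell : Formula m n → List (Sentence m) → Formula m n
    cell α βs = α ∧′ weaken (⋀ βs)
    cells = cartesianProductWith cell (C (radius d) n) (truthAssignments S)

    covers : ∀ A → A ∈ᵛ V → ∀ a → ∃[ ψ ] (ψ ∈ cells × (A ⊨ ψ [ a ]))
    covers A A∈ a =
      let βs , βs∈ , p = truthAssignments-cover A S
          α , (α∈ , q) , _ = unique (radius d) n A A∈ a
      in cell α βs , ∈-cartesianProductWith⁺ cell α∈ βs∈ , q , from (⊨weaken A (⋀ βs)) (from (⊨⋀ A βs) p)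

    decides : ∀ {ψ} → ψ ∈ cells → ∀ {A B a b} → A ∈ᵛ V → B ∈ᵛ V →
              A ⊨ ψ [ a ] → B ⊨ ψ [ b ] → A ⊨ φ [ a ] → B ⊨ φ [ b ]
    decides ψ∈ {A} {B} A∈ B∈
      with α , βs , α∈ , βs∈ , refl ← ∈-cartesianProductWith⁻ cell (C (radius d) n) (truthAssignments S) ψ∈ =
      λ (pα , pβ) (qα , qβ) → preserves d A∈ B∈
        (truthAssignments-agree S βs∈ (to (⊨⋀ A βs) (to (⊨weaken A (⋀ βs)) pβ))
                                              (to (⊨⋀ B βs) (to (⊨weaken B (⋀ βs)) qβ)))
        (ballIso⇒localIso (iso (radius d) n A B A∈ B∈ _ _ α α∈ pα qα))

    cell-disjunct : ∀ {ψ} → ψ ∈ cells → Disjunct C ψ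
    cell-disjunct ψ∈
      with α , βs , α∈ , βs∈ , refl ← ∈-cartesianProductWith⁻ cell (C (radius d) n) (truthAssignments S) ψ∈ =
      disjunct (radius d , α∈) (truthAssignments-literals (local d) βs∈)

theorem4p10 : ExcludedMiddle (lsuc 0ℓ) →
    ∀ (m : ℕ) (V : Variety m) → GeneralizedBijective V →
    ∀ (C : Choice m) → Admissible V C →
    (∀ (φ : Sentence m) →
    ∃[ φ* ] (BooleanCombination (LocalSentence C) φ* × EquivalentOver V φ φ*))
    × (∀ (n : ℕ) (φ : Formula m n) →
    ∃[ φ* ] (BooleanCombination (Local C) φ* × NormalForm C φ* × EquivalentOver V φ φ*))
theorem4p10 em₁ m V _ C adm = sentence-normalForm , λ n → formula-normalForm
  where open Locality adm em₁
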